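{- There exists an absolute constant $C>0$ such that for every integer $k\ge 1$ and every finite undirected unweighted graph $G$ whose vertex set can be covered by at most $k$ shortest paths (i.e., there are shortest paths $P_1,\dots,P_m$ of $G$, $m\le k$, with $V(G)=\bigcup_i V(P_i)$), the pathwidth of $G$ satisfies $\operatorname{pw}(G)\le C\cdot k\cdot 3^k$.
   Context: A path decomposition of $G=(V,E)$ is a sequence $(X_1,\dots,X_q)$ of subsets of $V$ such that every edge has both endpoints in some $X_i$, and for every vertex $x$ the indices $i$ with $x\in X_i$ form a contiguous interval. Its width is $\max_i |X_i|-1$, and $\operatorname{pw}(G)$ is the minimum width of a path decomposition of $G$. A shortest path is a path between two vertices whose number of edges equals their distance in $G$. -}

module Defs where

open import Data.Nat using (ℕ; zero; suc; _+_; _∸_; _≤_; _<_)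
open import Data.Bool using (Bool; true; false)
open import Data.Fin using (Fin)
open import Data.Fin.Subset using (Subset; ∣_∣) renaming (_∈_ to _∈ₛ_)
open import Data.List using (List; []; _∷_)
open import Data.List.Membership.Propositional using (_∈_)
open import Data.List.Relation.Unary.Unique.Propositional using (Unique)
open import Data.Product using (Σ; _×_; ∃)
open import Relation.Binary.PropositionalEquality using (_≡_)
open import Relation.Nullary using (¬_)

record Graph (n : ℕ) : Set where
  field
    adj   : Fin n → Fin n → Bool
    sym   : ∀ u v → adj u v ≡ adj v u
    irrefl : ∀ u → adj u u ≡ false
open Graph public

module _ {n : ℕ} (G : Graph n) where

  data Walk : Fin n → Fin n → Set where
    [_]  : (u : Fin n) → Walk u u
    _∷⟨_⟩_ : (u : Fin n) {v w : Fin n} → adj G u v ≡ true → Walk v w → Walk u w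

  len : ∀ {u v} → Walk u v → ℕ
  len [ u ] = zero
  len (u ∷⟨ _ ⟩ p) = suc (len p)

  vertices : ∀ {u v} → Walk u v → List (Fin n)
  vertices [ u ] = u ∷ []
  vertices (u ∷⟨ _ ⟩ p) = u ∷ vertices p

  IsPath : ∀ {u v} → Walk u v → Set
  IsPath p = Unique (vertices p)

  IsShortestPath : ∀ {u v} → Walk u v → Set
  IsShortestPath {u} {v} p = IsPath p × (∀ (q : Walk u v) → len p ≤ len q)

  record ShortestPath : Set where
    constructor sp
    field
      {start end} : Fin n
      walk     : Walk start end
      shortest : IsShortestPath walk

  CoveredByShortestPaths : ℕ → Set
  CoveredByShortestPaths k =
    Σ ℕ λ m → m ≤ k × Σ (Fin m → ShortestPath) λ P →
      ∀ (x : Fin n) → ∃ λ i → x ∈ vertices (ShortestPath.walk (P i))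

  record PathDecomposition : Set where
    field
      q     : ℕ
      bag   : Fin q → Subset n
      edges : ∀ u v → adj G u v ≡ true → ∃ λ i → u ∈ₛ bag i × v ∈ₛ bag i
      contiguous : ∀ (x : Fin n) (i j l : Fin q) →
        Data.Fin._≤_ i j → Data.Fin._≤_ j l → x ∈ₛ bag i → x ∈ₛ bag l → x ∈ₛ bag j

  HasWidthAtMost : PathDecomposition → ℕ → Set
  HasWidthAtMost D w = ∀ i → ∣ PathDecomposition.bag D i ∣ ∸ 1 ≤ w

  PathwidthAtMost : ℕ → Set
  PathwidthAtMost w = Σ PathDecomposition λ D → HasWidthAtMost D w

-- Colour each vertex by a covering path. Let f be the cheapest cost of reaching a
-- vertex from a root, where moving along a path costs its length and any other edge
-- costs W = 2k + 4; f changes by at most W on an edge, so the sets {i ≤ f ≤ i + W}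
-- form a path decomposition. A cheapest route never returns to a colour, and any
-- route through an extra colour costs about W more than a direct one. Call a set K of
-- vertices of one path ε-spread if |y - z| ≤ ε + f z - f y for y, z ∈ K with f y ≤ f z.
-- Take the earliest departure from K, to w of colour c. A route leaving K later
-- either never uses c, or enters c at once and leaves it at some z with
-- |w - z| ≤ ε + 2 + f z - f w; the z on either side of w form an (ε + 2)-spread set.
-- Removing c from the available colours in these three cases gives the factor 3^k,
-- and an ε-spread set meets {i ≤ f ≤ i + W} in O(k) vertices.
module Submission where

open import Defs
open import Data.Bool using (true; false)
open import Data.Fin using (Fin; zero; suc; toℕ; fromℕ<)
import Data.Fin.Properties as Fin
open import Data.Fin.Subset using (Subset; ∣_∣; _∪_; ⋃; ⁅_⁆) renaming (_∈_ to _∈ₛ_)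
open import Data.Fin.Subset.Properties
  using (x∈⁅x⁆; p⊆p∪q; q⊆p∪q; p⊆q⇒∣p∣≤∣q∣; ∣⊥∣≡0; ∣⁅x⁆∣≡1)
open import Data.List as List using (List; []; _∷_; length; map; filter; applyUpTo; upTo; allFin)
open import Data.List.Membership.Propositional using (_∈_)
open import Data.List.Membership.Propositional.Properties
  using (∈-++⁺ˡ; ∈-++⁺ʳ; ∈-applyUpTo⁺; ∈-upTo⁺; ∈-filter⁺; ∈-allFin)
open import Data.List.Properties using (length-++; length-applyUpTo; length-upTo; filter-notAll)
open import Data.List.Relation.Unary.All as All using (All; []; _∷_)
open import Data.List.Relation.Unary.All.Properties using (all-filter)
open import Data.List.Relation.Unary.Any as Any using (here; there)
open import Data.Nat
open import Data.Nat.Induction using (<-wellFounded)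
open import Data.Nat.Properties
open import Data.Nat.Tactic.RingSolver using (solve-∀)
open import Data.Product using (Σ; ∃; _×_; _,_; proj₁; proj₂)
open import Data.Sum as Sum using (_⊎_; inj₁; inj₂)
open import Data.Vec as Vec using ([]; _∷_)
open import Data.Vec.Properties using (lookup∘tabulate; lookup⇒[]=; []=⇒lookup)
open import Data.Vec.Functional using (foldr; updateAt)
open import Data.Vec.Functional.Properties using (updateAt-updates; updateAt-minimal)
open import Function using (_∘_; const)
open import Induction.WellFounded using (Acc; acc)
open import Relation.Binary.Definitions using (tri<; tri≈; tri>)
open import Relation.Binary.PropositionalEquality as ≡ using (_≡_; refl; cong; cong₂; subst; subst₂)
open import Relation.Nullary using (¬_; Dec; yes; no; does; proof; Reflects; contradiction; _×-dec_; ¬?)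
open import Relation.Nullary.Decidable using (dec-true)
open import Relation.Nullary.Reflects using (invert)

-- Certificate for linear inequalities: the hypotheses are summed into s ≤ t
-- and c is the slack, so that what remains is a semiring identity.
linear : ∀ {s t a b} c → s ≤ t → a + t + c ≡ b + s → a ≤ b
linear {s} {t} {a} {b} c s≤t eq = +-cancelʳ-≤ t a b (begin
  a + t      ≤⟨ m≤m+n (a + t) c ⟩
  a + t + c  ≡⟨ eq ⟩
  b + s      ≤⟨ +-monoʳ-≤ b s≤t ⟩
  b + t      ∎)
  where open ≤-Reasoning

-- Sizes and sums over finite sets.

∣p∪q∣≤∣p∣+∣q∣ : ∀ {n} (p q : Subset n) → ∣ p ∪ q ∣ ≤ ∣ p ∣ + ∣ q ∣
∣p∪q∣≤∣p∣+∣q∣ [] [] = z≤n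
∣p∪q∣≤∣p∣+∣q∣ (false ∷ p) (false ∷ q) = ∣p∪q∣≤∣p∣+∣q∣ p q
∣p∪q∣≤∣p∣+∣q∣ (false ∷ p) (true ∷ q) =
  ≤-trans (s≤s (∣p∪q∣≤∣p∣+∣q∣ p q)) (≤-reflexive (≡.sym (+-suc ∣ p ∣ ∣ q ∣)))
∣p∪q∣≤∣p∣+∣q∣ (true ∷ p) (false ∷ q) = s≤s (∣p∪q∣≤∣p∣+∣q∣ p q)
∣p∪q∣≤∣p∣+∣q∣ (true ∷ p) (true ∷ q) =
  s≤s (≤-trans (∣p∪q∣≤∣p∣+∣q∣ p q) (+-monoʳ-≤ ∣ p ∣ (n≤1+n ∣ q ∣)))

∈⇒∈⋃ : ∀ {n} {x : Fin n} {xs} → x ∈ xs → x ∈ₛ ⋃ (map ⁅_⁆ xs)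
∈⇒∈⋃ {x = x} (here refl) = p⊆p∪q _ (x∈⁅x⁆ x)
∈⇒∈⋃ (there x∈xs) = q⊆p∪q _ _ (∈⇒∈⋃ x∈xs)

∣⋃∣≤length : ∀ {n} (xs : List (Fin n)) → ∣ ⋃ (map ⁅_⁆ xs) ∣ ≤ length xs
∣⋃∣≤length {n} [] = ≤-reflexive (∣⊥∣≡0 n)
∣⋃∣≤length (x ∷ xs) = ≤-trans (∣p∪q∣≤∣p∣+∣q∣ ⁅ x ⁆ _)
  (+-mono-≤ (≤-reflexive (∣⁅x⁆∣≡1 x)) (∣⋃∣≤length xs))

enumerated⇒∣p∣≤length : ∀ {n} {p : Subset n} xs → (∀ {x} → x ∈ₛ p → x ∈ xs) → ∣ p ∣ ≤ length xs
enumerated⇒∣p∣≤length xs p⊆xs =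
  ≤-trans (p⊆q⇒∣p∣≤∣q∣ (∈⇒∈⋃ ∘ p⊆xs)) (∣⋃∣≤length xs)

bounded : ∀ {n} (g : Fin n → ℕ) → ∃ λ b → ∀ x → g x < b
bounded {zero} g = 0 , λ ()
bounded {suc n} g with bounded (g ∘ suc)
... | b , g<b = suc (g zero) ⊔ b , λ
  { zero → m≤m⊔n (suc (g zero)) b
  ; (suc x) → ≤-trans (g<b x) (m≤n⊔m (suc (g zero)) b) }

total : ∀ {n} → (Fin n → ℕ) → ℕ
total = foldr _+_ 0

total-mono-≤ : ∀ {n} {g h : Fin n → ℕ} → (∀ x → g x ≤ h x) → total g ≤ total h
total-mono-≤ {zero} g≤h = z≤n
total-mono-≤ {suc n} g≤h = +-mono-≤ (g≤h zero) (total-mono-≤ (g≤h ∘ suc))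

total-mono-< : ∀ {n} {g h : Fin n → ℕ} → (∀ x → g x ≤ h x) → ∀ x → g x < h x → total g < total h
total-mono-< g≤h zero gx<hx = +-mono-<-≤ gx<hx (total-mono-≤ (g≤h ∘ suc))
total-mono-< g≤h (suc x) gx<hx = +-mono-≤-< (g≤h zero) (total-mono-< (g≤h ∘ suc) x gx<hx)

-- Cheapest routes by relaxation.

record Potential {n} (init : Fin n → ℕ) (w : Fin n → Fin n → ℕ) : Set where
  field
    value     : Fin n → ℕ
    ≤init     : ∀ x → value x ≤ init x
    lipschitz : ∀ y x → value x ≤ value y + w y x
    tight     : ∀ x → value x ≡ init x ⊎
                  ∃ λ y → value y < value x × value x ≡ value y + w y x

module _ {n} (init : Fin n → ℕ) (w : Fin n → Fin n → ℕ)
  (w≡0⇒≡ : ∀ {y x} → w y x ≡ 0 → y ≡ x) where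

  private
    -- Only an inequality is kept, since lowering `g y` later preserves it; once no violated step is
    -- left, the Lipschitz bound makes it an equality. Positive weight makes the predecessor
    -- strictly cheaper.
    Supported : (Fin n → ℕ) → Set
    Supported g = ∀ x → g x ≡ init x ⊎ ∃ λ y → 0 < w y x × g y + w y x ≤ g x

    -- Bellman-Ford relaxation: repairing a violated step lowers one value, so `total g` strictly
    -- decreases and the process stops.
    relax : (g : Fin n → ℕ) → (∀ x → g x ≤ init x) → Supported g →
            Acc _<_ (total g) → Potential init w
    relax g g≤init supp (acc rs) with Fin.any? (λ x → Fin.any? (λ y → g y + w y x <? g x))
    ... | no ¬violated = record
      { value = g ; ≤init = g≤init ; lipschitz = lip ; tight = tight }
      where
      lip : ∀ y x → g x ≤ g y + w y x
      lip y x = ≮⇒≥ (λ lt → ¬violated (x , y , lt))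
      tight : ∀ x → g x ≡ init x ⊎ ∃ λ y → g y < g x × g x ≡ g y + w y x
      tight x with supp x
      ... | inj₁ eq = inj₁ eq
      ... | inj₂ (y , 0<w , le) = inj₂ (y , ≤-trans (m<m+n (g y) 0<w) le , ≤-antisym (lip y x) le)
    ... | yes (x , y , lt) = relax g′ (λ z → ≤-trans (g′≤g z) (g≤init z)) supp′
            (rs (total-mono-< g′≤g x g′x<gx))
      where
      v = g y + w y x
      g′ = updateAt g x (const v)
      g′x≡v : g′ x ≡ v
      g′x≡v = updateAt-updates x g
      g′x<gx : g′ x < g x
      g′x<gx = subst (_< g x) (≡.sym g′x≡v) lt
      g′≤g : ∀ z → g′ z ≤ g z
      g′≤g z with z Fin.≟ x
      ... | yes refl = <⇒≤ g′x<gx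
      ... | no z≢x = ≤-reflexive (updateAt-minimal z x g z≢x)
      0<w : 0 < w y x
      0<w with w y x in eq
      ... | suc _ = z<s
      -- A step of weight 0 is a loop, and a loop cannot be violated.
      ... | zero = contradiction (<-≤-trans lt (begin
        g x      ≡⟨ cong g (w≡0⇒≡ eq) ⟨
        g y      ≤⟨ m≤m+n (g y) _ ⟩
        g y + _  ∎)) (<-irrefl refl)
        where open ≤-Reasoning
      supp′ : Supported g′
      supp′ z with z Fin.≟ x
      ... | yes refl = inj₂ (y , 0<w , ≤-trans (+-monoˡ-≤ (w y x) (g′≤g y)) (≤-reflexive (≡.sym g′x≡v)))
      ... | no z≢x with supp z
      ...   | inj₁ eq = inj₁ (≡.trans (updateAt-minimal z x g z≢x) eq)
      ...   | inj₂ (u , 0<w′ , le) = inj₂ (u , 0<w′ ,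
              ≤-trans (+-monoˡ-≤ (w u z) (g′≤g u)) (≤-trans le (≤-reflexive (≡.sym (updateAt-minimal z x g z≢x)))))

  potential : Potential init w
  potential = relax init (λ _ → ≤-refl) (λ _ → inj₁ refl) (<-wellFounded _)

-- Walks and segments of shortest paths.

module _ {n} {G : Graph n} where

  infixr 5 _++_
  _++_ : ∀ {u v w} → Walk G u v → Walk G v w → Walk G u w
  [ _ ] ++ q = q
  (u ∷⟨ e ⟩ p) ++ q = u ∷⟨ e ⟩ (p ++ q)

  len-++ : ∀ {u v w} (p : Walk G u v) (q : Walk G v w) → len G (p ++ q) ≡ len G p + len G q
  len-++ [ _ ] q = refl
  len-++ (u ∷⟨ e ⟩ p) q = cong suc (len-++ p q)

  edge : ∀ {u v} → adj G u v ≡ true → Walk G u v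
  edge {u} {v} e = u ∷⟨ e ⟩ [ v ]

  reverse : ∀ {u v} → Walk G u v → Walk G v u
  reverse [ u ] = [ u ]
  reverse (u ∷⟨ e ⟩ p) = reverse p ++ edge (≡.trans (sym G _ u) e)

  len-reverse : ∀ {u v} (p : Walk G u v) → len G (reverse p) ≡ len G p
  len-reverse [ u ] = refl
  len-reverse (u ∷⟨ e ⟩ p) = ≡.trans (len-++ (reverse p) _)
    (≡.trans (+-comm (len G (reverse p)) 1) (cong suc (len-reverse p)))

  -- Positions beyond the end are read as the end vertex.
  at : ∀ {u v} → Walk G u v → ℕ → Fin n
  at [ u ] _ = u
  at (u ∷⟨ _ ⟩ p) zero = u
  at (u ∷⟨ _ ⟩ p) (suc i) = at p i

  prefix : ∀ {u v} (p : Walk G u v) i → Σ (Walk G u (at p i)) λ q → len G q ≤ i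
  prefix [ u ] i = [ u ] , z≤n
  prefix (u ∷⟨ e ⟩ p) zero = [ u ] , z≤n
  prefix (u ∷⟨ e ⟩ p) (suc i) = u ∷⟨ e ⟩ proj₁ (prefix p i) , s≤s (proj₂ (prefix p i))

  suffix : ∀ {u v} (p : Walk G u v) {i} → i ≤ len G p →
           Σ (Walk G (at p i) v) λ q → len G q + i ≡ len G p
  suffix [ u ] z≤n = [ u ] , refl
  suffix (u ∷⟨ e ⟩ p) z≤n = u ∷⟨ e ⟩ p , +-identityʳ _
  suffix (u ∷⟨ e ⟩ p) {suc i} (s≤s i≤) with suffix p i≤
  ... | q , eq = q , ≡.trans (+-suc (len G q) i) (cong suc eq)

  segment : ∀ {u v} (p : Walk G u v) {i j} → i ≤ j →
            Σ (Walk G (at p i) (at p j)) λ q → len G q ≤ j ∸ i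
  segment [ u ] _ = [ u ] , z≤n
  segment (u ∷⟨ e ⟩ p) {j = j} z≤n = prefix (u ∷⟨ e ⟩ p) j
  segment (u ∷⟨ e ⟩ p) (s≤s i≤j) = segment p i≤j

  index : ∀ {u v x} (p : Walk G u v) → x ∈ vertices G p → ∃ λ i → i ≤ len G p × at p i ≡ x
  index [ u ] (here refl) = 0 , z≤n , refl
  index (u ∷⟨ e ⟩ p) (here refl) = 0 , z≤n , refl
  index (u ∷⟨ e ⟩ p) (there x∈p) with index p x∈p
  ... | i , i≤ , eq = suc i , s≤s i≤ , eq

  -- Splicing `q` between the prefix up to position `i` and the suffix from position `j` gives a
  -- walk with the ends of `p`, hence one no shorter than `p`.
  shortest-segment : ∀ {u v} (p : Walk G u v) → IsShortestPath G p →
    ∀ {i j} → j ≤ len G p → (q : Walk G (at p i) (at p j)) → j ≤ i + len G q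
  shortest-segment p (_ , shortest) {i} {j} j≤ q
    with prefix p i | suffix p j≤
  ... | a , a≤ | b , b≡ = +-cancelʳ-≤ (len G b) j (i + len G q) (begin
    j + len G b                  ≡⟨ ≡.trans (+-comm j _) b≡ ⟩
    len G p                      ≤⟨ shortest (a ++ q ++ b) ⟩
    len G (a ++ q ++ b)          ≡⟨ ≡.trans (len-++ a (q ++ b)) (cong (len G a +_) (len-++ q b)) ⟩
    len G a + (len G q + len G b) ≤⟨ +-monoˡ-≤ _ a≤ ⟩
    i + (len G q + len G b)      ≡⟨ +-assoc i _ _ ⟨
    i + len G q + len G b        ∎)
    where open ≤-Reasoning

-- Absolute differences of natural numbers.

∣-∣+≤ : ∀ {a b u v} → a + u ≤ b + v → b + u ≤ a + v → ∣ a - b ∣ + u ≤ v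
∣-∣+≤ {a} {b} {u} {v} a≤ b≤ with ≤-total a b
... | inj₁ a≤b = +-cancelˡ-≤ a _ _ (begin
  a + (∣ a - b ∣ + u)  ≡⟨ +-assoc a _ u ⟨
  a + ∣ a - b ∣ + u    ≡⟨ cong (λ d → a + d + u) (m≤n⇒∣m-n∣≡n∸m a≤b) ⟩
  a + (b ∸ a) + u      ≡⟨ cong (_+ u) (m+[n∸m]≡n a≤b) ⟩
  b + u                ≤⟨ b≤ ⟩
  a + v                ∎)
  where open ≤-Reasoning
... | inj₂ b≤a = +-cancelˡ-≤ b _ _ (begin
  b + (∣ a - b ∣ + u)  ≡⟨ +-assoc b _ u ⟨
  b + ∣ a - b ∣ + u    ≡⟨ cong (λ d → b + d + u) (m≤n⇒∣n-m∣≡n∸m b≤a) ⟩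
  b + (a ∸ b) + u      ≡⟨ cong (_+ u) (m+[n∸m]≡n b≤a) ⟩
  a + u                ≤⟨ a≤ ⟩
  b + v                ∎)
  where open ≤-Reasoning

∣-∣≤ : ∀ {a b c} → a ≤ b + c → b ≤ a + c → ∣ a - b ∣ ≤ c
∣-∣≤ {a} {b} {c} a≤ b≤ = subst (_≤ c) (+-identityʳ ∣ a - b ∣)
  (∣-∣+≤ {a} {b} (subst (_≤ b + c) (≡.sym (+-identityʳ a)) a≤) (subst (_≤ a + c) (≡.sym (+-identityʳ b)) b≤))

∣m∸o-n∸o∣ : ∀ {m n o} → o ≤ m → o ≤ n → ∣ m ∸ o - n ∸ o ∣ ≡ ∣ m - n ∣
∣m∸o-n∸o∣ {m} {n} {o} o≤m o≤n = begin
  ∣ m ∸ o - n ∸ o ∣              ≡⟨ ∣m+n-m+o∣≡∣n-o∣ o _ _ ⟨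
  ∣ o + (m ∸ o) - o + (n ∸ o) ∣  ≡⟨ cong₂ ∣_-_∣ (m+[n∸m]≡n o≤m) (m+[n∸m]≡n o≤n) ⟩
  ∣ m - n ∣                      ∎
  where open ≡.≡-Reasoning

∣o∸m-o∸n∣ : ∀ {m n o} → m ≤ o → n ≤ o → ∣ o ∸ m - o ∸ n ∣ ≡ ∣ m - n ∣
∣o∸m-o∸n∣ {m} {n} {o} m≤o n≤o = begin
  ∣ o ∸ m - o ∸ n ∣                                  ≡⟨ ∣m+n-m+o∣≡∣n-o∣ (m + n) _ _ ⟨
  ∣ m + n + (o ∸ m) - m + n + (o ∸ n) ∣              ≡⟨ cong₂ ∣_-_∣ (rearrange m n _) (+-assoc m n _) ⟩
  ∣ n + (m + (o ∸ m)) - m + (n + (o ∸ n)) ∣          ≡⟨ cong₂ (λ a b → ∣ n + a - m + b ∣) (m+[n∸m]≡n m≤o) (m+[n∸m]≡n n≤o) ⟩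
  ∣ n + o - m + o ∣                                  ≡⟨ cong₂ ∣_-_∣ (+-comm n o) (+-comm m o) ⟩
  ∣ o + n - o + m ∣                                  ≡⟨ ∣m+n-m+o∣≡∣n-o∣ o n m ⟩
  ∣ n - m ∣                                          ≡⟨ ∣-∣-comm n m ⟩
  ∣ m - n ∣                                          ∎
  where
  open ≡.≡-Reasoning
  rearrange : ∀ m n a → m + n + a ≡ n + (m + a)
  rearrange = solve-∀

-- Colouring the vertices by covering paths.

record GeodesicColouring {n} (G : Graph n) (k : ℕ) : Set where
  field
    colour    : Fin n → ℕ
    colour<k  : ∀ x → colour x < k
    pos       : Fin n → ℕ
    vertexAt  : Fin n → ℕ → Fin n
    vertexAt-pos : ∀ {x y} → colour x ≡ colour y → vertexAt x (pos y) ≡ y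
    slide     : ∀ {x y} → colour x ≡ colour y →
                Σ (Walk G x y) λ p → len G p ≤ ∣ pos x - pos y ∣
    geodesic  : ∀ {x y} → colour x ≡ colour y → (p : Walk G x y) →
                ∣ pos x - pos y ∣ ≤ len G p

-- Each vertex keeps just one of the paths through it, so a path may contain vertices of other
-- colours and a slide may pass through them.
colouring : ∀ {n k} {G : Graph n} → CoveredByShortestPaths G k → GeodesicColouring G k
colouring {n} {k} {G} (m , m≤k , P , cover) = record
  { colour = toℕ ∘ c
  ; colour<k = λ x → <-≤-trans (Fin.toℕ<n (c x)) m≤k
  ; pos = pos
  ; vertexAt = λ x → at (path (c x))
  ; vertexAt-pos = at-pos ∘ Fin.toℕ-injective
  ; slide = slide ∘ Fin.toℕ-injective
  ; geodesic = geodesic ∘ Fin.toℕ-injective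
  }
  where
  path : ∀ i → Walk G _ _
  path i = ShortestPath.walk (P i)
  c : Fin n → Fin m
  c x = proj₁ (cover x)
  indexOf : ∀ x → ∃ λ i → i ≤ len G (path (c x)) × at (path (c x)) i ≡ x
  indexOf x = index (path (c x)) (proj₂ (cover x))
  pos : Fin n → ℕ
  pos x = proj₁ (indexOf x)
  pos≤ : ∀ {x y} → c x ≡ c y → pos y ≤ len G (path (c x))
  pos≤ {y = y} eq = subst (λ i → pos y ≤ len G (path i)) (≡.sym eq) (proj₁ (proj₂ (indexOf y)))
  at-pos : ∀ {x y} → c x ≡ c y → at (path (c x)) (pos y) ≡ y
  at-pos {y = y} eq = subst (λ i → at (path i) (pos y) ≡ y) (≡.sym eq) (proj₂ (proj₂ (indexOf y)))

  slide : ∀ {x y} → c x ≡ c y → Σ (Walk G x y) λ p → len G p ≤ ∣ pos x - pos y ∣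
  slide {x} {y} eq = subst₂ ShortWalk (at-pos {x} refl) (at-pos eq) walk
    where
    ShortWalk : Fin n → Fin n → Set
    ShortWalk u v = Σ (Walk G u v) λ p → len G p ≤ ∣ pos x - pos y ∣
    walk : ShortWalk (at (path (c x)) (pos x)) (at (path (c x)) (pos y))
    walk with ≤-total (pos x) (pos y)
    ... | inj₁ x≤y with segment (path (c x)) x≤y
    ...   | p , p≤ = p , ≤-trans p≤ (≤-reflexive (≡.sym (m≤n⇒∣m-n∣≡n∸m x≤y)))
    walk | inj₂ y≤x with segment (path (c x)) y≤x
    ...   | p , p≤ = reverse p , (begin
      len G (reverse p)  ≡⟨ len-reverse p ⟩
      len G p            ≤⟨ p≤ ⟩
      pos x ∸ pos y      ≡⟨ m≤n⇒∣n-m∣≡n∸m y≤x ⟨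
      ∣ pos x - pos y ∣  ∎)
      where open ≤-Reasoning

  ahead : ∀ {x y} → c x ≡ c y → (p : Walk G x y) → pos y ≤ pos x + len G p
  ahead {x} {y} eq p = go (at-pos {x} refl) (at-pos eq) p
    where
    go : ∀ {u v} → at (path (c x)) (pos x) ≡ u → at (path (c x)) (pos y) ≡ v →
         (q : Walk G u v) → pos y ≤ pos x + len G q
    go refl refl q = shortest-segment (path (c x)) (ShortestPath.shortest (P (c x))) (pos≤ eq) q

  geodesic : ∀ {x y} → c x ≡ c y → (p : Walk G x y) → ∣ pos x - pos y ∣ ≤ len G p
  geodesic {x} {y} eq p = ∣-∣≤
    (subst (λ l → pos x ≤ pos y + l) (len-reverse p) (ahead (≡.sym eq) (reverse p)))
    (ahead eq p)

-- The cost function and its tight routes.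

module Layers {n} {G : Graph n} {k} (Γ : GeodesicColouring G k) where
  open GeodesicColouring Γ

  -- `late-visit-impossible` needs `W > 3 + ε`, and ε stays within `2 * k`: it starts at 0 and grows
  -- by 2 for each removed colour.
  W Λ : ℕ
  W = 4 + 2 * k
  Λ = proj₁ (bounded pos)

  pos<Λ : ∀ x → pos x < Λ
  pos<Λ = proj₂ (bounded pos)

  dist : Fin n → Fin n → ℕ
  dist x y = ∣ pos x - pos y ∣

  pos-injective : ∀ {x y} → colour x ≡ colour y → pos x ≡ pos y → x ≡ y
  pos-injective {x} {y} cx≡cy px≡py = begin
    x                   ≡⟨ vertexAt-pos refl ⟨
    vertexAt x (pos x)  ≡⟨ cong (vertexAt x) px≡py ⟩
    vertexAt x (pos y)  ≡⟨ vertexAt-pos cx≡cy ⟩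
    y                   ∎
    where open ≡.≡-Reasoning

  -- As Λ > pos, a route from a root of colour j meets no larger colour, since the
  -- vertices there are initially cheaper; hence the roots contribute at most Σⱼ 3^j.
  init : Fin n → ℕ
  init x = Λ * (k ∸ colour x) + pos x

  -- The last weight stands for ∞: it never makes a step tight, as f ≤ init.
  weight : Fin n → Fin n → ℕ
  weight y x with colour y ≟ colour x
  ... | yes _ = dist y x
  ... | no _ with adj G y x
  ...   | true = W
  ...   | false = suc (init x)

  weight≡0⇒≡ : ∀ {y x} → weight y x ≡ 0 → y ≡ x
  weight≡0⇒≡ {y} {x} eq with colour y ≟ colour x
  ... | yes c≡ = pos-injective c≡ (∣m-n∣≡0⇒m≡n eq)
  ... | no _ with adj G y x
  weight≡0⇒≡ () | no _ | true
  weight≡0⇒≡ () | no _ | false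

  open Potential (potential init weight weight≡0⇒≡) renaming (value to f; ≤init to f≤init)

  slide-lipschitz : ∀ {y x} → colour y ≡ colour x → f x ≤ f y + dist y x
  slide-lipschitz {y} {x} c≡ with colour y ≟ colour x | lipschitz y x
  ... | yes _ | le = le
  ... | no c≢ | _ = contradiction c≡ c≢

  edge-lipschitz : ∀ {y x} → adj G y x ≡ true → f x ≤ f y + W
  edge-lipschitz {y} {x} e with colour y ≟ colour x | lipschitz y x
  ... | yes c≡ | le = ≤-trans le (+-monoʳ-≤ (f y) (≤-trans (geodesic c≡ (edge {G = G} e)) (s≤s z≤n)))
  ... | no _ | le with adj G y x
  edge-lipschitz refl | no _ | le | true = le

  Root : ℕ → Fin n → Set
  Root j x = colour x ≡ j × f x ≡ Λ * (k ∸ j) + pos x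

  -- A jump is bundled with the slide after it, of length 0 if need be, so that a route becomes a
  -- sequence of hops and each hop contributes one colour.
  record Hop (y z : Fin n) : Set where
    field
      entry       : Fin n
      jump        : adj G y entry ≡ true
      jump-tight  : f entry ≡ f y + W
      same-colour : colour entry ≡ colour z
      slide-tight : f z ≡ f entry + dist entry z

  tight-cases : ∀ x → Root (colour x) x
    ⊎ (∃ λ y → f y < f x × colour y ≡ colour x × f x ≡ f y + dist y x)
    ⊎ (∃ λ y → f y < f x × adj G y x ≡ true × f x ≡ f y + W)
  tight-cases x with tight x
  ... | inj₁ eq = inj₁ (refl , eq)
  ... | inj₂ (y , lt , eq) with colour y ≟ colour x
  ...   | yes c≡ = inj₂ (inj₁ (y , lt , c≡ , eq))
  ...   | no _ with adj G y x in e
  ...     | true = inj₂ (inj₂ (y , lt , e , eq))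
  ...     | false = contradiction (f≤init x)
              (<⇒≱ (≤-trans (m≤n+m (suc (init x)) (f y)) (≤-reflexive (≡.sym eq))))

  data Tail : Fin n → Fin n → Set where
    done : ∀ {x} → Tail x x
    hop  : ∀ {y z x} → Hop y z → Tail z x → Tail y x

  colours : ∀ {y x} → Tail y x → List ℕ
  colours done = []
  colours (hop {z = z} _ t) = colour z ∷ colours t

  dist-triangle : ∀ x y z → dist x z ≤ dist x y + dist y z
  dist-triangle x y z = ∣-∣-triangle (pos x) (pos y) (pos z)

  -- The Lipschitz property gives one bound and the triangle inequality the other, so consecutive
  -- tight slides merge.
  slide-trans : ∀ {x y z} → colour x ≡ colour z → f y ≡ f x + dist x y →
                f z ≡ f y + dist y z → f z ≡ f x + dist x z
  slide-trans {x} {y} {z} c≡ eq₁ eq₂ = ≤-antisym (slide-lipschitz c≡) (begin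
    f x + dist x z               ≤⟨ +-monoʳ-≤ (f x) (dist-triangle x y z) ⟩
    f x + (dist x y + dist y z)  ≡⟨ +-assoc (f x) _ _ ⟨
    f x + dist x y + dist y z    ≡⟨ cong (_+ dist y z) eq₁ ⟨
    f y + dist y z               ≡⟨ eq₂ ⟨
    f z                          ∎)
    where open ≤-Reasoning

  -- The last hop absorbs the slide. If there is no hop, the route is still at `r`, and `root-slide`
  -- makes the end of the slide the new root.
  tail-slide : ∀ {r y x} → Tail r y → colour y ≡ colour x → f x ≡ f y + dist y x → r ≡ y ⊎ Tail r x
  tail-slide done _ _ = inj₁ refl
  tail-slide (hop h t) c≡ eq with tail-slide t c≡ eq
  ... | inj₂ t′ = inj₂ (hop h t′)
  ... | inj₁ refl = inj₂ (hop (record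
    { entry = entry ; jump = jump ; jump-tight = jump-tight
    ; same-colour = c≡′
    ; slide-tight = slide-trans c≡′ slide-tight eq }) done)
    where
    open Hop h
    c≡′ = ≡.trans same-colour c≡

  tail-jump : ∀ {r y x} → Tail r y → adj G y x ≡ true → f x ≡ f y + W → Tail r x
  tail-jump {x = x} done e eq = hop (record
    { entry = x ; jump = e ; jump-tight = eq ; same-colour = refl
    ; slide-tight = ≡.sym (≡.trans (cong (f x +_) (∣n-n∣≡0 (pos x))) (+-identityʳ (f x))) }) done
  tail-jump (hop h t) e eq = hop h (tail-jump t e eq)

  -- `pos` grows by at most `dist y x`, so the cost of a tight slide from a root is at least the
  -- initial cost of its end, which `f` never exceeds.
  root-slide : ∀ {j y x} → Root j y → colour y ≡ colour x → f x ≡ f y + dist y x → Root j x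
  root-slide {j} {y} {x} (refl , fy) c≡ eq = ≡.sym c≡ , ≤-antisym
    (subst (λ i → f x ≤ Λ * (k ∸ i) + pos x) (≡.sym c≡) (f≤init x)) (begin
    Λ * (k ∸ j) + pos x              ≤⟨ +-monoʳ-≤ (Λ * (k ∸ j)) (m≤n+∣n-m∣ (pos x) (pos y)) ⟩
    Λ * (k ∸ j) + (pos y + dist y x) ≡⟨ +-assoc (Λ * (k ∸ j)) _ _ ⟨
    Λ * (k ∸ j) + pos y + dist y x   ≡⟨ cong (_+ dist y x) fy ⟨
    f y + dist y x                   ≡⟨ eq ⟨
    f x                              ∎)
    where open ≤-Reasoning

  history : ∀ x → ∃ λ r → Root (colour r) r × Tail r x
  history x = go x (<-wellFounded (f x))
    where
    go : ∀ x → Acc _<_ (f x) → ∃ λ r → Root (colour r) r × Tail r x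
    go x (acc rs) with tight-cases x
    ... | inj₁ root = x , root , done
    ... | inj₂ (inj₁ (y , lt , c≡ , eq)) with go y (rs lt)
    ...   | r , root , t with tail-slide t c≡ eq
    ...     | inj₂ t′ = r , root , t′
    ...     | inj₁ refl = x , subst (λ j → Root j x) c≡ (root-slide root c≡ eq) , done
    go x (acc rs) | inj₂ (inj₂ (y , lt , e , eq)) with go y (rs lt)
    ...   | r , root , t = r , root , tail-jump t e eq

  -- Cost of hops against length of walks.

  -- Each of s hops costs W but is at most one edge of G, so a tight tail costs
  -- s (W - 1) more than the length of the walk in G that it follows.
  Far : ℕ → Fin n → Fin n → Set
  Far s y z = Σ (Walk G y z) λ p → len G p + f y + s * W ≤ s + f z

  hop-far : ∀ {y z} → Hop y z → Far 1 y z
  hop-far {y} {z} h with slide (Hop.same-colour h)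
  ... | p , p≤ = edge {G = G} jump ++ p ,
    arith (len G p) (dist entry z) (f y) (f entry) (f z) k p≤ jump-tight slide-tight
    where
    open Hop h
    arith : ∀ l d y e z k → l ≤ d → e ≡ y + (4 + 2 * k) → z ≡ e + d →
            suc l + y + 1 * (4 + 2 * k) ≤ 1 + z
    arith l d y _ _ k l≤d refl refl = linear 0 l≤d (eq l d y k)
      where
      eq : ∀ l d y k → suc l + y + 1 * (4 + 2 * k) + d + 0 ≡ 1 + (y + (4 + 2 * k) + d) + l
      eq = solve-∀

  far-trans : ∀ {s t y z x} → Far s y z → Far t z x → Far (s + t) y x
  far-trans {s} {t} {y} {z} {x} (p , p≤) (q , q≤) = p ++ q ,
    subst (λ l → l + f y + (s + t) * W ≤ s + t + f x) (≡.sym (len-++ p q))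
      (linear 0 (+-mono-≤ p≤ q≤) (eq (len G p) (len G q) (f y) (f z) (f x) s t k))
    where
    eq : ∀ l m y z x s t k → l + m + y + (s + t) * (4 + 2 * k) + (s + z + (t + x)) + 0
         ≡ s + t + x + (l + y + s * (4 + 2 * k) + (m + z + t * (4 + 2 * k)))
    eq = solve-∀

  visit : ∀ {y x c} (t : Tail y x) → c ∈ colours t → ∃ λ z → colour z ≡ c × ∃ λ s → Far (suc s) y z
  visit (hop {z = z} h t) (here refl) = z , refl , 0 , hop-far h
  visit (hop h t) (there c∈t) with visit t c∈t
  ... | z , cz≡c , s , far = z , cz≡c , suc s , far-trans (hop-far h) far

  far-increasing : ∀ {s y z} → Far (suc s) y z → f y ≤ f z
  far-increasing {s} {y} {z} (p , p≤) = linear (len G p + 3 + 2 * k + s * (3 + 2 * k)) p≤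
    (eq (len G p) (f y) (f z) s k)
    where
    eq : ∀ l y z s k → y + (suc s + z) + (l + 3 + 2 * k + s * (3 + 2 * k))
         ≡ z + (l + y + suc s * (4 + 2 * k))
    eq = solve-∀

  -- Had the tail come back to the colour of `y`, a direct slide would be cheaper: it costs at most
  -- the length of the walk followed, whereas each hop adds `W - 1` to that length.
  no-return : ∀ {y x} (t : Tail y x) → ¬ colour y ∈ colours t
  no-return {y} t c∈t with visit t c∈t
  ... | z , cz≡cy , s , p , p≤ = contradiction
    (linear {a = 1} {b = 0} (2 + 2 * k + s * (3 + 2 * k))
      (+-mono-≤ p≤ (+-mono-≤ (slide-lipschitz (≡.sym cz≡cy)) (geodesic (≡.sym cz≡cy) p)))
      (eq (len G p) (f y) (f z) (dist y z) s k)) λ ()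
    where
    eq : ∀ l y z d s k → 1 + (suc s + z + (y + d + l)) + (2 + 2 * k + s * (3 + 2 * k))
         ≡ 0 + (l + y + suc s * (4 + 2 * k) + (z + d))
    eq = solve-∀

  -- Spread sets and departures from them.

  record Spread (K : Fin n → Set) (ε : ℕ) : Set where
    field
      monochromatic : ∀ {y z} → K y → K z → colour y ≡ colour z
      spread        : ∀ {y z} → K y → K z → f y ≤ f z → dist y z + f y ≤ ε + f z

  module AfterDeparture {K ε} (K-spread : Spread K ε) {y₀ w₀ y : Fin n} (Ky₀ : K y₀) (Ky : K y)
    (e₀ : adj G y₀ w₀ ≡ true) (w₀-tight : f w₀ ≡ f y₀ + W) (y₀≤y : f y₀ ≤ f y) where
    open Spread K-spread

    -- The competing walk goes back over the jump edge to `y₀`, along the path of `K` to `y`, and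
    -- then follows `p`.
    detour : ∀ {z} → colour w₀ ≡ colour z → (p : Walk G y z) → dist w₀ z ≤ 1 + dist y₀ y + len G p
    detour {z} c≡ p with slide (monochromatic Ky₀ Ky)
    ... | q , q≤ = begin
      dist w₀ z                       ≤⟨ geodesic c≡ (reverse (edge {G = G} e₀) ++ q ++ p) ⟩
      suc (len G (q ++ p))            ≡⟨ cong suc (len-++ q p) ⟩
      1 + len G q + len G p           ≤⟨ s≤s (+-monoˡ-≤ (len G p) q≤) ⟩
      1 + dist y₀ y + len G p         ∎
      where open ≤-Reasoning

    -- Jumping to `w₀` and sliding to `z` pays `W` once, the given route at least twice. With
    -- `detour` and the spread of `K` all distances cancel and `(1 + s) * W ≤ 3 + s + ε` remains,
    -- which is false.
    late-visit-impossible : ∀ {z s} → ε ≤ 2 * k → colour w₀ ≡ colour z → ¬ Far (2 + s) y z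
    late-visit-impossible {z} {s} ε≤ c≡ (p , p≤) = contradiction
      (linear {a = 1} {b = 0} (3 * s + 2 * k * s)
        (+-mono-≤ p≤ (+-mono-≤ (subst (λ v → f z ≤ v + dist w₀ z) w₀-tight (slide-lipschitz c≡))
          (+-mono-≤ (detour c≡ p) (+-mono-≤ (spread Ky₀ Ky y₀≤y) ε≤))))
        (eq (len G p) (f y) (f z) (f y₀) (dist w₀ z) (dist y₀ y) s ε k)) λ ()
      where
      eq : ∀ l y z y₀ D d s ε k →
           1 + (2 + s + z + (y₀ + (4 + 2 * k) + D + (1 + d + l + (ε + y + 2 * k)))) + (3 * s + 2 * k * s)
           ≡ 0 + (l + y + (2 + s) * (4 + 2 * k) + (z + (D + (d + y₀ + ε))))
      eq = solve-∀

    -- The 2 counts two edges: the jump into `w₀`, which the detour traverses, and the jump out of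
    -- `y`. The costs `W` of the two jumps cancel.
    direct-visit-near : ∀ {z} → colour w₀ ≡ colour z → Far 1 y z → dist w₀ z + f w₀ ≤ 2 + ε + f z
    direct-visit-near {z} c≡ (p , p≤) = subst (λ v → dist w₀ z + v ≤ 2 + ε + f z) (≡.sym w₀-tight)
      (linear 0 (+-mono-≤ p≤ (+-mono-≤ (detour c≡ p) (spread Ky₀ Ky y₀≤y)))
        (eq (len G p) (f y) (f z) (f y₀) (dist w₀ z) (dist y₀ y) ε k))
      where
      eq : ∀ l y z y₀ D d ε k →
           D + (y₀ + (4 + 2 * k)) + (1 + z + (1 + d + l + (ε + y))) + 0
           ≡ 2 + ε + z + (l + y + 1 * (4 + 2 * k) + (D + (d + y₀)))
      eq = solve-∀

  Near Right Left : Fin n → ℕ → Fin n → Set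
  Near w ε z = colour w ≡ colour z × dist w z + f w ≤ ε + f z
  Right w ε z = Near w ε z × pos w ≤ pos z
  Left w ε z = Near w ε z × pos z ≤ pos w

  -- For `z` near `w`, `dist w z` exceeds `f z - f w` by between 0 and ε. On one side of `w`, mutual
  -- distances are differences of such numbers, so the error is again at most ε; across `w` they
  -- would be sums.
  side-spread : ∀ {K w ε} → (∀ {z} → K z → Near w ε z) →
    (∀ {y z} → K y → K z → dist y z ≡ ∣ dist w y - dist w z ∣) → Spread K ε
  side-spread {K} {w} {ε} near side = record
    { monochromatic = λ Ky Kz → ≡.trans (≡.sym (proj₁ (near Ky))) (proj₁ (near Kz))
    ; spread = λ {y} {z} Ky Kz y≤z → subst (λ d → d + f y ≤ ε + f z) (≡.sym (side Ky Kz))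
        (∣-∣+≤ {dist w y}
          -- `y≤z` enters twice: the distances give a bound with `f y - f z`, and `f z - f y` is
          -- wanted.
          (linear 0 (+-mono-≤ (proj₂ (near Ky))
                      (+-mono-≤ (slide-lipschitz (proj₁ (near Kz))) (+-mono-≤ y≤z y≤z)))
             (eq₁ (dist w y) (dist w z) (f y) (f z) (f w) ε))
          (linear 0 (+-mono-≤ (proj₂ (near Kz)) (slide-lipschitz (proj₁ (near Ky))))
             (eq₂ (dist w y) (dist w z) (f y) (f z) (f w) ε))) }
    where
    eq₁ : ∀ a b y z w ε → a + y + (ε + y + (w + b + (z + z))) + 0 ≡ b + (ε + z) + (a + w + (z + (y + y)))
    eq₁ = solve-∀
    eq₂ : ∀ a b y z w ε → b + y + (ε + z + (w + a)) + 0 ≡ a + (ε + z) + (b + w + y)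
    eq₂ = solve-∀

  right-spread : ∀ {w ε} → Spread (Right w ε) ε
  right-spread {w} = side-spread proj₁ λ {y} {z} (_ , w≤y) (_ , w≤z) →
    ≡.sym (≡.trans (cong₂ ∣_-_∣ (m≤n⇒∣m-n∣≡n∸m w≤y) (m≤n⇒∣m-n∣≡n∸m w≤z)) (∣m∸o-n∸o∣ w≤y w≤z))

  left-spread : ∀ {w ε} → Spread (Left w ε) ε
  left-spread {w} = side-spread proj₁ λ {y} {z} (_ , y≤w) (_ , z≤w) →
    ≡.sym (≡.trans (cong₂ ∣_-_∣ (m≤n⇒∣n-m∣≡n∸m y≤w) (m≤n⇒∣n-m∣≡n∸m z≤w)) (∣o∸m-o∸n∣ y≤w z≤w))

  Reached : (Fin n → Set) → List ℕ → Fin n → Set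
  Reached K R x = ∃ λ y → K y × Σ (Tail y x) λ t → All (_∈ R) (colours t)

  record Departs (K : Fin n → Set) (R : List ℕ) (b : ℕ) (x : Fin n) : Set where
    constructor departs
    field
      {exit target} : Fin n
      exit∈K  : K exit
      b≤exit  : b ≤ f exit
      first   : Hop exit target
      rest    : Tail target x
      allowed : All (_∈ R) (colours (hop first rest))

  record Departure (K : Fin n → Set) (R : List ℕ) : Set where
    constructor departure
    field
      {exit entry} : Fin n
      exit∈K : K exit
      jump   : adj G exit entry ≡ true
      jump-tight : f entry ≡ f exit + W
      colour∈R : colour entry ∈ R

  departs-weaken : ∀ {K R a b x} → a ≤ b → Departs K R b x → Departs K R a x
  departs-weaken a≤b (departs Ky b≤y h t al) = departs Ky (≤-trans a≤b b≤y) h t al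

  departure-of : ∀ {K R y z} → K y → Hop y z → colour z ∈ R → Departure K R
  departure-of {R = R} Ky h cz∈R =
    departure Ky jump jump-tight (subst (_∈ R) (≡.sym same-colour) cz∈R)
    where open Hop h

  -- Induction along the list, keeping an exit of least `f`; a lower exit only weakens the bounds
  -- already recorded. A vertex with an empty tail lies in `K`.
  earliest : ∀ {K R xs} → All (Reached K R) xs →
    All K xs ⊎ Σ (Departure K R) λ D → All (λ x → K x ⊎ Departs K R (f (Departure.exit D)) x) xs
  earliest [] = inj₁ []
  earliest ((_ , Kx , done , _) ∷ rs) with earliest rs
  ... | inj₁ Ks = inj₁ (Kx ∷ Ks)
  ... | inj₂ (D , ds) = inj₂ (D , inj₁ Kx ∷ ds)
  earliest ((y , Ky , hop h t , al@(c∈R ∷ _)) ∷ rs) with earliest rs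
  ... | inj₁ Ks =
    inj₂ (departure-of Ky h c∈R , inj₂ (departs Ky ≤-refl h t al) ∷ All.map inj₁ Ks)
  ... | inj₂ (D , ds) with ≤-total (f (Departure.exit D)) (f y)
  ...   | inj₁ D≤y = inj₂ (D , inj₂ (departs Ky D≤y h t al) ∷ ds)
  ...   | inj₂ y≤D = inj₂ (departure-of Ky h c∈R ,
            inj₂ (departs Ky ≤-refl h t al) ∷ All.map (Sum.map₂ (departs-weaken y≤D)) ds)

  _without_ : List ℕ → ℕ → List ℕ
  R without c = filter (λ d → ¬? (d ≟ c)) R

  length-without : ∀ {c R} → c ∈ R → length (R without c) < length R
  length-without {c} {R} c∈R = filter-notAll _ R (Any.map (λ c≡d d≢c → d≢c (≡.sym c≡d)) c∈R)

  all-without : ∀ {c R} ds → All (_∈ R) ds → ¬ c ∈ ds → All (_∈ (R without c)) ds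
  all-without {c} {R} ds ds⊆R c∉ds = All.tabulate λ {d} d∈ds →
    ∈-filter⁺ (λ d → ¬? (d ≟ c)) (All.lookup ds⊆R d∈ds) λ { refl → c∉ds d∈ds }

  -- Counting the vertices of a window.

  module Window (lo : ℕ) where

    InWindow : Fin n → Set
    InWindow x = lo ≤ f x × f x ≤ lo + W

    -- Lists carry the evidence for `P`, which need not be decidable: unions are split and the
    -- earliest departure is found by inspecting it.
    Coverable : (Fin n → Set) → ℕ → Set
    Coverable P N = ∀ xs → All P xs → All InWindow xs →
      Σ (List (Fin n)) λ L → length L ≤ N × All (_∈ L) xs

    coverable-≤ : ∀ {P N M} → N ≤ M → Coverable P N → Coverable P M
    coverable-≤ N≤M cov xs ps ws with cov xs ps ws
    ... | L , L≤ , xs⊆L = L , ≤-trans L≤ N≤M , xs⊆L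

    coverable-∪ : ∀ {P Q N M} → Coverable P N → Coverable Q M → Coverable (λ x → P x ⊎ Q x) (N + M)
    coverable-∪ {P} {Q} covP covQ xs ps ws with split xs ps ws
      where
      split : ∀ xs → All (λ x → P x ⊎ Q x) xs → All InWindow xs →
        Σ (List (Fin n)) λ ys → Σ (List (Fin n)) λ zs →
          All P ys × All InWindow ys × All Q zs × All InWindow zs × All (λ x → x ∈ ys ⊎ x ∈ zs) xs
      split [] [] [] = [] , [] , [] , [] , [] , [] , []
      split (x ∷ xs) (p ∷ ps) (w ∷ ws) with split xs ps ws | p
      ... | ys , zs , Py , wy , Qz , wz , sub | inj₁ Px =
        x ∷ ys , zs , Px ∷ Py , w ∷ wy , Qz , wz ,
        inj₁ (here refl) ∷ All.map (Sum.map₁ there) sub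
      ... | ys , zs , Py , wy , Qz , wz , sub | inj₂ Qx =
        ys , x ∷ zs , Py , wy , Qx ∷ Qz , w ∷ wz ,
        inj₂ (here refl) ∷ All.map (Sum.map₂ there) sub
    ... | ys , zs , Py , wy , Qz , wz , sub with covP ys Py wy | covQ zs Qz wz
    ...   | L , L≤ , ys⊆L | M , M≤ , zs⊆M = L List.++ M ,
      ≤-trans (≤-reflexive (length-++ L)) (+-mono-≤ L≤ M≤) ,
      All.map Sum.[ (λ x∈ys → ∈-++⁺ˡ (All.lookup ys⊆L x∈ys)) , (λ x∈zs → ∈-++⁺ʳ L (All.lookup zs⊆M x∈zs)) ] sub

    B : ℕ
    B = suc (8 + 8 * k)

    -- Members of `K` in the window are at distance at most `ε + W ≤ 4 + 4 * k`, and `B` is the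
    -- number of positions within this radius of a fixed member.
    spread-coverable : ∀ {K ε} → Spread K ε → ε ≤ 2 * k → Coverable K B
    spread-coverable K-spread ε≤ [] _ _ = [] , z≤n , []
    spread-coverable {K} {ε} K-spread ε≤ (x ∷ xs) (Kx ∷ Ks) (wx ∷ ws) =
      applyUpTo entry B , ≤-reflexive (length-applyUpTo entry B) ,
      All.zipWith (λ (Ky , wy) → covered Ky wy) (Kx ∷ Ks , wx ∷ ws)
      where
      open Spread K-spread
      radius base : ℕ
      radius = 4 + 4 * k
      -- If the subtraction is cut off at 0, the `B` positions from `base` on still reach
      -- `pos x + radius`.
      base = pos x ∸ radius
      entry : ℕ → Fin n
      entry i = vertexAt x (base + i)
      arith : ∀ {d a b} → d + a ≤ ε + b → lo ≤ a → b ≤ lo + W → d ≤ radius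
      arith {d} {a} {b} d≤ lo≤a b≤ = linear 0 (+-mono-≤ d≤ (+-mono-≤ lo≤a (+-mono-≤ b≤ ε≤))) (eq d a b lo ε k)
        where
        eq : ∀ d a b l ε k → d + (ε + b + (a + (l + (4 + 2 * k) + 2 * k))) + 0
             ≡ 4 + 4 * k + (d + a + (l + (b + ε)))
        eq = solve-∀
      close : ∀ {y} → K y → InWindow y → dist x y ≤ radius
      close {y} Ky (lo≤y , y≤) with ≤-total (f x) (f y)
      ... | inj₁ x≤y = arith (spread Kx Ky x≤y) (proj₁ wx) y≤
      ... | inj₂ y≤x = subst (_≤ radius) (∣-∣-comm (pos y) (pos x)) (arith (spread Ky Kx y≤x) lo≤y (proj₂ wx))
      covered : ∀ {y} → K y → InWindow y → y ∈ applyUpTo entry B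
      covered {y} Ky wy = subst (_∈ applyUpTo entry B)
        (≡.trans (cong (vertexAt x) (m+[n∸m]≡n base≤y)) (vertexAt-pos (monochromatic Kx Ky)))
        (∈-applyUpTo⁺ entry (s≤s (m≤n+o⇒m∸n≤o (pos y) base above)))
        where
        base≤y : base ≤ pos y
        base≤y = m≤n+o⇒m∸n≤o (pos x) radius (≤-trans (m≤n+∣m-n∣ (pos x) (pos y))
          (≤-trans (+-monoʳ-≤ (pos y) (close Ky wy)) (≤-reflexive (+-comm (pos y) radius))))
        above : pos y ≤ base + (8 + 8 * k)
        above = linear 0 (+-mono-≤ (m≤n+∣n-m∣ (pos y) (pos x)) (+-mono-≤ (close Ky wy) (m≤n+m∸n (pos x) radius)))
          (eq (pos y) (pos x) (dist x y) base k)
          where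
          eq : ∀ y x d b k → y + (x + d + (4 + 4 * k + (4 + 4 * k + b))) + 0 ≡ b + (8 + 8 * k) + (y + (d + x))
          eq = solve-∀

    reached-coverable : ∀ r {K ε R} → Spread K ε → length R ≤ r → ε + 2 * r ≤ 2 * k →
                        Coverable (Reached K R) (B * 3 ^ r)
    reached-coverable r {K} {ε} {R} K-spread R≤r ε≤ xs ps ws with earliest ps
    ... | inj₁ Ks = coverable-≤ (m≤m*n B (3 ^ r) ⦃ m^n≢0 3 r ⦄)
                      (spread-coverable K-spread (m+n≤o⇒m≤o ε ε≤)) xs Ks ws
    ... | inj₂ (D , ds) = bound r R≤r ε≤
      where
      open Departure D renaming (exit to y₀; entry to w₀)
      c = colour w₀
      R′ = R without c
      ε≤2k : ε ≤ 2 * k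
      ε≤2k = m+n≤o⇒m≤o ε ε≤

      classify : ∀ {x} → K x ⊎ Departs K R (f y₀) x →
        Reached K R′ x ⊎ (Reached (Right w₀ (2 + ε)) R′ x ⊎ Reached (Left w₀ (2 + ε)) R′ x)
      classify {x} (inj₁ Kx) = inj₁ (x , Kx , done , [])
      classify (inj₂ (departs {y} {z} Ky y₀≤y h t (cz∈R ∷ t⊆R))) with colour z ≟ c
      ... | yes cz≡c = inj₂ (side (≤-total (pos w₀) (pos z)))
        where
        open AfterDeparture K-spread exit∈K Ky jump jump-tight y₀≤y
        near : Near w₀ (2 + ε) z
        near = ≡.sym cz≡c , direct-visit-near (≡.sym cz≡c) (hop-far h)
        t⊆R′ : All (_∈ R′) (colours t)
        -- The first hop already ends in colour `c`, so the rest never comes back to it.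
        t⊆R′ = all-without (colours t) t⊆R (subst (λ c → ¬ c ∈ colours t) cz≡c (no-return t))
        side : pos w₀ ≤ pos z ⊎ pos z ≤ pos w₀ → _
        side (inj₁ w≤z) = inj₁ (z , (near , w≤z) , t , t⊆R′)
        side (inj₂ z≤w) = inj₂ (z , (near , z≤w) , t , t⊆R′)
      ... | no cz≢c = inj₁ (y , Ky , hop h t , all-without _ (cz∈R ∷ t⊆R) c∉)
        where
        open AfterDeparture K-spread exit∈K Ky jump jump-tight y₀≤y
        c∉ : ¬ c ∈ colours (hop h t)
        c∉ (here c≡cz) = cz≢c (≡.sym c≡cz)
        c∉ (there c∈t) with visit t c∈t
        -- Here `c` would be reached at the second hop or later.
        ... | u , cu≡c , s , far = late-visit-impossible ε≤2k (≡.sym cu≡c) (far-trans {s = 1} (hop-far h) far)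

      bound : ∀ r → length R ≤ r → ε + 2 * r ≤ 2 * k →
              Σ (List (Fin n)) λ L → length L ≤ B * 3 ^ r × All (_∈ L) xs
      bound zero R≤0 _ = contradiction (≤-trans (length-without colour∈R) R≤0) λ ()
      bound (suc r) R≤ ε≤′ = coverable-≤ (≤-reflexive (triple B (3 ^ r)))
        (coverable-∪ (reached-coverable r K-spread R′≤ (≤-trans (+-monoʳ-≤ ε (*-monoʳ-≤ 2 (n≤1+n r))) ε≤′))
          (coverable-∪ (reached-coverable r right-spread R′≤ ε′≤)
                       (reached-coverable r left-spread R′≤ ε′≤)))
        xs (All.map classify ds) ws
        where
        R′≤ : length R′ ≤ r
        R′≤ = s≤s⁻¹ (≤-trans (length-without colour∈R) R≤)
        ε′≤ : 2 + ε + 2 * r ≤ 2 * k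
        ε′≤ = ≤-trans (≤-reflexive (shift ε r)) ε≤′
          where
          shift : ∀ ε r → 2 + ε + 2 * r ≡ ε + 2 * suc r
          shift = solve-∀
        triple : ∀ b p → b * p + (b * p + b * p) ≡ b * (3 * p)
        triple = solve-∀

    root-spread : ∀ {j} → Spread (Root j) 0
    root-spread {j} = record
      { monochromatic = λ (cy , _) (cz , _) → ≡.trans cy (≡.sym cz)
      ; spread = λ {y} {z} (_ , fy) (_ , fz) y≤z →
          ≤-reflexive (gap (pos y) (pos z) fy fz y≤z) }
      where
      gap : ∀ {a b} p q → a ≡ Λ * (k ∸ j) + p → b ≡ Λ * (k ∸ j) + q → a ≤ b → ∣ p - q ∣ + a ≡ b
      gap p q refl refl a≤b = begin
        ∣ p - q ∣ + (Λ * (k ∸ j) + p)  ≡⟨ cong (_+ (Λ * (k ∸ j) + p)) (m≤n⇒∣m-n∣≡n∸m p≤q) ⟩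
        q ∸ p + (Λ * (k ∸ j) + p)      ≡⟨ swap (q ∸ p) (Λ * (k ∸ j)) p ⟩
        Λ * (k ∸ j) + (p + (q ∸ p))    ≡⟨ cong (Λ * (k ∸ j) +_) (m+[n∸m]≡n p≤q) ⟩
        Λ * (k ∸ j) + q                ∎
        where
        open ≡.≡-Reasoning
        p≤q : p ≤ q
        p≤q = +-cancelˡ-≤ (Λ * (k ∸ j)) p q a≤b
        swap : ∀ d l p → d + (l + p) ≡ l + (p + d)
        swap = solve-∀

    -- `f` does not decrease from `y` to any later hop, yet on colours above `j` already `init` lies
    -- below `f y`. Colour `j` itself is excluded by `no-return`.
    root-colours : ∀ {j y x} → Root j y → (t : Tail y x) → All (_∈ upTo j) (colours t)
    root-colours {j} {y} (refl , fy) t = All.tabulate smaller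
      where
      smaller : ∀ {c} → c ∈ colours t → c ∈ upTo j
      smaller {c} c∈t with <-cmp c j
      ... | tri< c<j _ _ = ∈-upTo⁺ c<j
      ... | tri≈ _ refl _ = contradiction c∈t (no-return t)
      ... | tri> _ _ j<c with visit t c∈t
      ...   | z , refl , s , far = contradiction (begin-strict
        f y                              ≤⟨ far-increasing far ⟩
        f z                              ≤⟨ f≤init z ⟩
        Λ * (k ∸ colour z) + pos z       <⟨ +-monoʳ-< _ (pos<Λ z) ⟩
        Λ * (k ∸ colour z) + Λ           ≡⟨ +-comm _ Λ ⟩
        Λ + Λ * (k ∸ colour z)           ≡⟨ *-suc Λ (k ∸ colour z) ⟨
        Λ * suc (k ∸ colour z)           ≤⟨ *-monoʳ-≤ Λ (∸-monoʳ-< j<c (<⇒≤ (colour<k z))) ⟩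
        Λ * (k ∸ j)                      ≤⟨ m≤m+n _ (pos y) ⟩
        Λ * (k ∸ j) + pos y              ≡⟨ fy ⟨
        f y                              ∎) (<-irrefl refl)
        where open ≤-Reasoning

    FromRootBelow : ℕ → Fin n → Set
    FromRootBelow j x = ∃ λ i → i < j × Reached (Root i) (upTo i) x

    -- Colour `j` adds `B * 3 ^ j`, the same as the bound for all smaller colours, and the double is
    -- below `B * 3 ^ suc j`: the geometric sum fits into the same form.
    below-coverable : ∀ j → j ≤ k → Coverable (FromRootBelow j) (B * 3 ^ j)
    below-coverable zero _ [] _ _ = [] , z≤n , []
    below-coverable zero _ (_ ∷ _) ((_ , () , _) ∷ _)
    below-coverable (suc j) j<k xs ps ws = coverable-≤ double
      (coverable-∪ (below-coverable j (<⇒≤ j<k))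
        (reached-coverable j root-spread (≤-reflexive (length-upTo j)) (*-monoʳ-≤ 2 (<⇒≤ j<k))))
      xs (All.map last? ps) ws
      where
      last? : ∀ {x} → FromRootBelow (suc j) x → FromRootBelow j x ⊎ Reached (Root j) (upTo j) x
      last? (i , i<1+j , reached) with m<1+n⇒m<n∨m≡n i<1+j
      ... | inj₁ i<j = inj₁ (i , i<j , reached)
      ... | inj₂ refl = inj₂ reached
      double : B * 3 ^ j + B * 3 ^ j ≤ B * 3 ^ suc j
      double = linear (B * 3 ^ j) (z≤n {0}) (eq B (3 ^ j))
        where
        eq : ∀ b p → b * p + b * p + 0 + b * p ≡ b * (3 * p) + 0
        eq = solve-∀

    fromRoot : ∀ x → FromRootBelow k x
    fromRoot x with history x
    ... | r , root , t = colour r , colour<k r , r , root , t , root-colours root t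

    inWindow? : ∀ x → Dec (InWindow x)
    inWindow? x = lo ≤? f x ×-dec f x ≤? lo + W

    layer : Subset n
    layer = Vec.tabulate (λ x → does (inWindow? x))

    InWindow⇒∈layer : ∀ {x} → InWindow x → x ∈ₛ layer
    InWindow⇒∈layer {x} w = lookup⇒[]= x layer
      (≡.trans (lookup∘tabulate _ x) (dec-true (inWindow? x) w))

    ∈layer⇒InWindow : ∀ {x} → x ∈ₛ layer → InWindow x
    ∈layer⇒InWindow {x} x∈ = invert
      (subst (Reflects (InWindow x)) (≡.trans (≡.sym (lookup∘tabulate _ x)) ([]=⇒lookup x∈)) (proof (inWindow? x)))

    ∣layer∣≤ : ∣ layer ∣ ≤ B * 3 ^ k
    ∣layer∣≤ with below-coverable k ≤-refl (filter inWindow? (allFin n)) (All.tabulate λ {x} _ → fromRoot x)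
                   (all-filter inWindow? (allFin n))
    ... | L , L≤ , xs⊆L = ≤-trans (enumerated⇒∣p∣≤length L λ {x} x∈ →
      All.lookup xs⊆L (∈-filter⁺ inWindow? (∈-allFin x) (∈layer⇒InWindow x∈))) L≤

  -- The path decomposition and its width.

  open Window using (layer; InWindow⇒∈layer; ∈layer⇒InWindow; ∣layer∣≤)

  decomposition : PathDecomposition G
  decomposition = record
    { q = proj₁ (bounded f)
    ; bag = λ i → layer (toℕ i)
    ; edges = edges
    -- Bag `i` contains `x` exactly when `i ≤ f x ≤ i + W`; the first bound is inherited from `l`,
    -- the second from `i`.
    ; contiguous = λ x i j l i≤j j≤l x∈i x∈l → InWindow⇒∈layer (toℕ j)
        ( ≤-trans j≤l (proj₁ (∈layer⇒InWindow (toℕ l) x∈l))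
        , ≤-trans (proj₂ (∈layer⇒InWindow (toℕ i) x∈i)) (+-monoˡ-≤ W i≤j) ) }
    where
    level : Fin n → Fin (proj₁ (bounded f))
    level x = fromℕ< (proj₂ (bounded f) x)
    x∈level : ∀ u x → f u ≤ f x → f x ≤ f u + W → x ∈ₛ layer (toℕ (level u))
    x∈level u x u≤x x≤ = subst (λ l → x ∈ₛ layer l) (≡.sym (Fin.toℕ-fromℕ< (proj₂ (bounded f) u)))
      (InWindow⇒∈layer (f u) (u≤x , x≤))
    edges : ∀ u v → adj G u v ≡ true → ∃ λ i → u ∈ₛ layer (toℕ i) × v ∈ₛ layer (toℕ i)
    edges u v e with ≤-total (f u) (f v)
    ... | inj₁ u≤v = level u , x∈level u u ≤-refl (m≤m+n (f u) W) , x∈level u v u≤v (edge-lipschitz e)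
    ... | inj₂ v≤u = level v , x∈level v u v≤u (edge-lipschitz (≡.trans (sym G v u) e)) ,
                     x∈level v v ≤-refl (m≤m+n (f v) W)

  pathwidth : 1 ≤ k → PathwidthAtMost G (17 * k * 3 ^ k)
  pathwidth 1≤k = decomposition , λ i → begin
    ∣ layer (toℕ i) ∣ ∸ 1     ≤⟨ m∸n≤m _ 1 ⟩
    ∣ layer (toℕ i) ∣         ≤⟨ ∣layer∣≤ (toℕ i) ⟩
    -- `1 ≤ k` absorbs the constant 9 of `B` into `9 * k`.
    (9 + 8 * k) * 3 ^ k       ≤⟨ *-monoˡ-≤ (3 ^ k) (+-monoˡ-≤ (8 * k) (*-monoʳ-≤ 9 1≤k)) ⟩
    (9 * k + 8 * k) * 3 ^ k   ≡⟨ cong (_* 3 ^ k) (*-distribʳ-+ k 9 8) ⟨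
    17 * k * 3 ^ k            ∎
    where open ≤-Reasoning

theorem2 : Σ ℕ λ C → 0 < C ×
    (∀ (k : ℕ) → 1 ≤ k → ∀ (n : ℕ) (G : Graph n) →
    CoveredByShortestPaths G k → PathwidthAtMost G (C * k * 3 ^ k))
theorem2 = 17 , z<s , λ k 1≤k n G covered → Layers.pathwidth (colouring covered) 1≤k
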